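{- The set $\mathbb Q$ of rational numbers, canonically arranged as below, has size sequence $$\sigma(\mathbb Q)=2\,\sigma(\mathbb I)\cdot(\alpha+1)+1,\quad\text{i.e. } \sigma_n(\mathbb Q)=2(n+1)\Phi(n)+1,$$ where $\Phi(n)=\sum_{i=1}^n\varphi(i)$ with $\varphi$ Euler's totient function; moreover $\sigma(\mathbb Q)\approx_\mathcal F\alpha^3$, and more precisely $$\tfrac{3}{5}(\alpha^3+\alpha^2)<_\mathcal F\sigma(\mathbb Q)<_\mathcal F\alpha^3-\alpha.$$
   Context: $\mathbb N=\{1,2,\dots\}$. Positive rationals are represented by triples $(p,k,m)$, $p\in\mathbb N_0$, $k,m\in\mathbb N$, $\gcd(k,m)=1$, $k\le m$, standing for $p+k/m$; the triple lies in the $n$-th component of $\mathbb Q^+$ where $n=\max\{\ell(p),m\}$, with $\ell(0)=1$ and $\ell(p)=p$ for $p\ge1$ (this is the product arrangement of $\mathbb N_0\times\mathbb I$, $\mathbb I=(0,1]\cap\mathbb Q$). Negative rationals $\mathbb Q^-$ are arranged so that $-x$ lies in the same component as $x\in\mathbb Q^+$, and $0$ lies in the first component; $\mathbb Q=\mathbb Q^+\cup\mathbb Q^-\cup\{0\}$ is arranged by componentwise union. The size sequence is $\sigma(A)=(\sigma_n(A))_n$ with $\sigma_n(A)$ the number of elements of $A$ in components $1,\dots,n$. $\alpha=(n)_n$; operations on sequences are componentwise; constants are identified with constant sequences. $(a_n)<_\mathcal F(b_n)$ iff $a_n<b_n$ for all sufficiently large $n$; $(a_n)\approx_\mathcal F(b_n)$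 iff some $k\in\mathbb N$ has $ka_n\ge b_n$ for all large $n$ and some $k$ has $kb_n\ge a_n$ for all large $n$. -}

module Defs where

open import Data.Nat using (ℕ; suc; _≤_; _⊔_; NonZero)
open import Data.Nat.Properties using (≤-antisym)
open import Data.Nat.GCD using (gcd)
open import Data.Nat.Coprimality using (coprime?)
open import Data.Nat.ListAction using (sum)
open import Data.Integer using (+_)
open import Data.Rational as ℚ using (ℚ; 0ℚ)
open import Data.Rational.Literals using (fromℤ)
open import Data.Fin using (Fin; zero; suc)
open import Data.Fin.Properties using (injective⇒≤)
open import Data.List using (List; _∷_; length; filter; map; upTo; lookup)
open import Data.List.Membership.Propositional using (_∈_)
open import Data.List.Membership.Propositional.Properties using (∈-lookup)
open import Data.List.Relation.Unary.All as All using ()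
open import Data.List.Relation.Unary.AllPairs using (_∷_)
open import Data.List.Relation.Unary.Any using (index)
open import Data.List.Relation.Unary.Any.Properties using (lookup-index)
open import Data.List.Relation.Unary.Unique.Propositional using (Unique)
open import Data.Product using (Σ-syntax; ∃-syntax; _×_; _,_; proj₁; proj₂)
open import Function using (_∘_; _⇔_; Equivalence)
open import Level using (0ℓ)
open import Relation.Binary.PropositionalEquality using (_≡_; refl; sym; trans; cong)
open import Relation.Nullary using (contradiction)
open import Relation.Unary using (Pred; _∪_)

-- Sequences indexed by {1, 2, …} are functions on ℕ whose value at 0 is
-- never used.

HasCardinality : {X : Set} → Pred X 0ℓ → ℕ → Set
HasCardinality P c =
  ∃[ xs ] Unique xs × (∀ x → x ∈ xs ⇔ P x) × length xs ≡ c

private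
  lookup-injective : {X : Set} {xs : List X} → Unique xs →
                     ∀ {i j} → lookup xs i ≡ lookup xs j → i ≡ j
  lookup-injective (_   ∷ _) {zero}  {zero}  _  = refl
  lookup-injective {xs = _ ∷ xs} (x∉ ∷ _) {zero} {suc j} eq =
    contradiction eq (All.lookup x∉ (∈-lookup {xs = xs} j))
  lookup-injective {xs = _ ∷ xs} (x∉ ∷ _) {suc i} {zero} eq =
    contradiction (sym eq) (All.lookup x∉ (∈-lookup {xs = xs} i))
  lookup-injective (_ ∷ u) {suc _} {suc _} eq = cong suc (lookup-injective u eq)

  unique-⊆⇒length≤ : {X : Set} {xs ys : List X} → Unique xs →
                     (∀ {x} → x ∈ xs → x ∈ ys) → length xs ≤ length ys
  unique-⊆⇒length≤ {xs = xs} {ys} u sub = injective⇒≤ {f = f} f-injective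
    where
    f : Fin (length xs) → Fin (length ys)
    f i = index (sub (∈-lookup i))

    f-injective : ∀ {i j} → f i ≡ f j → i ≡ j
    f-injective {i} {j} eq = lookup-injective u
      (trans (lookup-index (sub (∈-lookup i)))
      (trans (cong (lookup ys) eq)
             (sym (lookup-index (sub (∈-lookup j))))))

-- Hence a size sequence, as defined below, is determined at every n ≥ 1.
HasCardinality-unique : {X : Set} {P : Pred X 0ℓ} {c d : ℕ} →
                        HasCardinality P c → HasCardinality P d → c ≡ d
HasCardinality-unique (_ , u , e , refl) (_ , v , f , refl) = ≤-antisym
  (unique-⊆⇒length≤ u (Equivalence.from (f _) ∘ Equivalence.to (e _)))
  (unique-⊆⇒length≤ v (Equivalence.from (e _) ∘ Equivalence.to (f _)))

-- A n x : x lies in the n-th component (n ≥ 1).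
Arrangement : Set → Set₁
Arrangement X = ℕ → Pred X 0ℓ

InFirst : {X : Set} → Arrangement X → ℕ → Pred X 0ℓ
InFirst A n x = ∃[ i ] 1 ≤ i × i ≤ n × A i x

IsSizeSequence : {X : Set} → Arrangement X → (ℕ → ℕ) → Set
IsSizeSequence A s = ∀ n → 1 ≤ n → HasCardinality (InFirst A n) (s n)

ℕ⇒ℚ : ℕ → ℚ
ℕ⇒ℚ n = fromℤ (+ n)

record Fraction : Set where
  field
    k m : ℕ
    {{k≢0}} : NonZero k
    {{m≢0}} : NonZero m
    gcd≡1 : gcd k m ≡ 1
    k≤m : k ≤ m

  value : ℚ
  value = + k ℚ./ m

open Fraction using (m; value)

𝕀 : Arrangement ℚ
𝕀 n x = Σ[ f ∈ Fraction ] value f ≡ x × m f ≡ n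

ℓ : ℕ → ℕ
ℓ 0       = 1
ℓ (suc p) = suc p

ℚ⁺ : Arrangement ℚ
ℚ⁺ n q = ∃[ p ] Σ[ f ∈ Fraction ] ℕ⇒ℚ p ℚ.+ value f ≡ q × ℓ p ⊔ m f ≡ n

ℚ⁻ : Arrangement ℚ
ℚ⁻ n q = ℚ⁺ n (ℚ.- q)

𝟎 : Arrangement ℚ
𝟎 n q = q ≡ 0ℚ × n ≡ 1

ℚ± : Arrangement ℚ
ℚ± n = ℚ⁺ n ∪ ℚ⁻ n ∪ 𝟎 n

φ : ℕ → ℕ
φ n = length (filter (λ k → coprime? k n) (map suc (upTo n)))

Φ : ℕ → ℕ
Φ n = sum (map (φ ∘ suc) (upTo n))

Eventually : Pred ℕ 0ℓ → Set
Eventually P = ∃[ N ] ∀ n → N ≤ n → P n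

infix 4 _<F_ _≈F_

_<F_ : (ℕ → ℚ) → (ℕ → ℚ) → Set
a <F b = Eventually λ n → a n ℚ.< b n

_≈F_ : (ℕ → ℚ) → (ℕ → ℚ) → Set
a ≈F b =
    (∃[ k ] 1 ≤ k × Eventually λ n → ℕ⇒ℚ k ℚ.* a n ℚ.≥ b n)
  × (∃[ k ] 1 ≤ k × Eventually λ n → ℕ⇒ℚ k ℚ.* b n ℚ.≥ a n)

{-# OPTIONS --safe #-}

-- The sizes are counted by exhibiting every component as a disjoint union of
-- injective images; q = p + x with 0 < x ≤ 1 determines p and x.
--
-- The upper bound needs only φ(m) ≤ m − 1 for m ≥ 2, with some slack at m = 4, 6.
--
-- The lower bound needs 10 Φ(n) ≥ 3 n², and Φ(n) counts the pairs a ≤ b ≤ n with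
-- g = gcd(a, b) equal to 1.  A g prime to 6 is either 1, or some m ≤ M prime to 6
-- (and then g ∈ m ℤ ∖ (2m ℤ ∪ 3m ℤ)), or larger than M.  Since t(⌊n/m⌋) pairs have
-- m ∣ g, t being the triangular numbers, this gives up to O(n)
--   n²/3 ≤ Φ(n) + Σ n²/(3m²) + Σ_{M < m ≤ n} t(⌊n/m⌋),
-- the first sum being over 2 ≤ m ≤ M prime to 6 and the last being at most n²/M.
-- The limiting constant 1/3 − (1/3) Σ 1/m² = 0.3011… leaves enough room for 3/10.
module Submission where

open import Defs
open import Data.Nat as ℕ using (ℕ; zero; suc; _+_; _*_; _^_; _≤_; _<_; _⊔_; z≤n; s≤s; NonZero; _/_; _%_; _≟_; _≤?_)
import Data.Nat.Properties as ℕ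
open import Data.Nat.Coprimality using (Coprime; coprime?; gcd≡1⇒coprime; coprime⇒gcd≡1)
open import Data.Nat.Divisibility
open import Data.Nat.DivMod
open import Data.Nat.GCD using (gcd; gcd[m,n]∣m; gcd[m,n]∣n; gcd-greatest; gcd[m,n]≤n; gcd[m,n]≢0)
open import Data.Nat.ListAction using (sum)
open import Data.Nat.ListAction.Properties using (sum-++)
open import Data.Nat.Tactic.RingSolver using (solve; solve-∀)
open import Data.Integer as ℤ using (+_)
import Data.Integer.Properties as ℤ
open import Data.Rational as ℚ using (ℚ; 0ℚ; 1ℚ; ↥_; ↧ₙ_)
import Data.Rational.Properties as ℚ
import Data.Rational.Unnormalised as ℚᵘ
import Data.Rational.Unnormalised.Properties as ℚᵘ
open import Algebra.Properties.Group ℚ.+-0-group using (∙-cancelˡ; ⁻¹-involutive; //-rightDividesʳ)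
open import Data.Bool using (if_then_else_)
open import Data.Empty using (⊥)
open import Data.Fin using (zero; suc)
open import Data.List using (List; []; _∷_; _++_; _∷ʳ_; map; filter; length; upTo; cartesianProduct)
open import Data.List.Properties using (length-map; length-++; map-++; map-∘; upTo-∷ʳ; length-upTo; filter-notAll)
open import Data.List.Membership.Propositional using (_∈_; lose)
open import Data.List.Membership.Propositional.Properties
open import Data.List.Relation.Unary.All as All using ()
import Data.List.Relation.Unary.All.Properties as All
open import Data.List.Relation.Unary.AllPairs using ([]; _∷_)
open import Data.List.Relation.Unary.Any using (here; there)
open import Data.List.Relation.Unary.Unique.Propositional using (Unique)
import Data.List.Relation.Unary.Unique.Propositional.Properties as Unique
open import Data.Product using (∃-syntax; _×_; _,_; proj₁; proj₂; uncurry; map₁)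
open import Data.Sum using (_⊎_; inj₁; inj₂; [_,_]′)
open import Function using (_∘_; id; _⇔_; mk⇔; Equivalence)
open import Level using (0ℓ)
open import Relation.Binary.Definitions using (tri<; tri≈; tri>)
open import Relation.Binary.PropositionalEquality using (_≡_; refl; sym; trans; cong; cong₂; subst; module ≡-Reasoning)
open import Relation.Nullary using (Dec; does; ¬_; ¬?; _×-dec_; contradiction; yes; no)
open import Relation.Nullary.Decidable using (dec-true; dec-false)
open import Relation.Unary using (Pred; _∪_; Decidable)
open Equivalence using (to; from)

-- Finite cardinalities and initial segments of arrangements

private variable
  X Y : Set
  𝒫 𝒬 : Pred X 0ℓ
  ∣𝒫∣ ∣𝒬∣ : ℕ

-- Injectivity is asked only on the entries of `xs`, because a map such as (p, x) ↦ p + x is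
-- injective only on the pairs that get counted.
unique-map : {f : X → Y} {xs : List X} →
             (∀ {x y} → x ∈ xs → y ∈ xs → f x ≡ f y → x ≡ y) →
             Unique xs → Unique (map f xs)
unique-map inj []       = []
unique-map inj (x∉ ∷ u) =
  All.map⁺ (All.tabulate λ y∈ eq →
    All.lookup x∉ y∈ (inj (here refl) (there y∈) eq))
  ∷ unique-map (λ x∈ y∈ → inj (there x∈) (there y∈)) u

cardinality-image : (f : X → Y) → (∀ {x y} → 𝒫 x → 𝒫 y → f x ≡ f y → x ≡ y) →
                    (∀ y → 𝒬 y ⇔ (∃[ x ] 𝒫 x × f x ≡ y)) →
                    HasCardinality 𝒫 ∣𝒫∣ → HasCardinality 𝒬 ∣𝒫∣
cardinality-image {𝒫 = 𝒫} {𝒬 = 𝒬} f inj image (xs , u , e , refl) =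
    map f xs
  , unique-map (λ x∈ y∈ → inj (to (e _) x∈) (to (e _) y∈)) u
  , (λ y → mk⇔ (to′ y) (from′ y))
  , length-map f xs
  where
  to′ : ∀ y → y ∈ map f xs → 𝒬 y
  to′ y y∈ with x , x∈ , refl ← ∈-map⁻ f y∈ = from (image y) (x , to (e x) x∈ , refl)

  from′ : ∀ y → 𝒬 y → y ∈ map f xs
  from′ y q with x , p , refl ← to (image y) q = ∈-map⁺ f (from (e x) p)

cardinality-⇔ : (∀ x → 𝒬 x ⇔ 𝒫 x) → HasCardinality 𝒫 ∣𝒫∣ → HasCardinality 𝒬 ∣𝒫∣
cardinality-⇔ eq = cardinality-image id (λ _ _ → id)
  λ x → mk⇔ (λ q → x , to (eq x) q , refl) λ { (_ , p , refl) → from (eq x) p }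

cardinality-∪ : (∀ {x} → 𝒫 x → 𝒬 x → ⊥) →
                HasCardinality 𝒫 ∣𝒫∣ → HasCardinality 𝒬 ∣𝒬∣ → HasCardinality (𝒫 ∪ 𝒬) (∣𝒫∣ + ∣𝒬∣)
cardinality-∪ disjoint (xs , u , e , refl) (ys , v , f , refl) =
    xs ++ ys
  , Unique.++⁺ u v (λ (x∈xs , x∈ys) → disjoint (to (e _) x∈xs) (to (f _) x∈ys))
  , (λ x → mk⇔ ([ inj₁ ∘ to (e x) , inj₂ ∘ to (f x) ]′ ∘ ∈-++⁻ xs)
                [ ∈-++⁺ˡ ∘ from (e x) , ∈-++⁺ʳ xs ∘ from (f x) ]′)
  , length-++ xs

cardinality-× : HasCardinality 𝒫 ∣𝒫∣ → HasCardinality 𝒬 ∣𝒬∣ →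
                HasCardinality (λ (x , y) → 𝒫 x × 𝒬 y) (∣𝒫∣ * ∣𝒬∣)
cardinality-× (xs , u , e , refl) (ys , v , f , refl) =
    cartesianProduct xs ys
  , Unique.cartesianProduct⁺ u v
  , (λ (x , y) → mk⇔
      (λ xy∈ → let x∈ , y∈ = ∈-cartesianProduct⁻ xs ys xy∈ in to (e x) x∈ , to (f y) y∈)
      (λ (p , q) → ∈-cartesianProduct⁺ (from (e x) p) (from (f y) q)))
  , length-product xs
  where
  length-product : ∀ xs → length (cartesianProduct xs ys) ≡ length xs * length ys
  length-product []       = refl
  length-product (x ∷ xs) = trans (length-++ (map (x ,_) ys))
    (cong₂ _+_ (length-map (x ,_) ys) (length-product xs))

cardinality-∅ : (∀ x → ¬ 𝒫 x) → HasCardinality 𝒫 0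
cardinality-∅ empty = [] , [] , (λ x → mk⇔ (λ ()) (λ p → contradiction p (empty x))) , refl

cardinality-singleton : (x : X) → HasCardinality (_≡ x) 1
cardinality-singleton x =
  x ∷ [] , All.All.[] ∷ [] , (λ y → mk⇔ (λ { (here eq) → eq ; (there ()) }) here) , refl

module _ {A : Arrangement X} where

  InFirst-suc : ∀ n x → InFirst A (suc n) x ⇔ (InFirst A n x ⊎ A (suc n) x)
  InFirst-suc n x = mk⇔ to′ from′
    where
    to′ : InFirst A (suc n) x → InFirst A n x ⊎ A (suc n) x
    to′ (i , 1≤i , i≤1+n , a) with ℕ.m≤n⇒m<n∨m≡n i≤1+n
    ... | inj₁ (s≤s i≤n) = inj₁ (i , 1≤i , i≤n , a)
    ... | inj₂ refl      = inj₂ a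

    from′ : InFirst A n x ⊎ A (suc n) x → InFirst A (suc n) x
    from′ (inj₁ (i , 1≤i , i≤n , a)) = i , 1≤i , ℕ.m≤n⇒m≤1+n i≤n , a
    from′ (inj₂ a)                   = suc n , s≤s z≤n , ℕ.≤-refl , a

-- The size sequence of `𝕀`

range : ℕ → List ℕ
range n = map suc (upTo n)

range-∷ʳ : ∀ n → range n ∷ʳ suc n ≡ range (suc n)
range-∷ʳ n = trans (sym (map-++ suc (upTo n) (n ∷ []))) (cong (map suc) (upTo-∷ʳ n))

∈-range⁺ : ∀ {k n} → 1 ≤ k → k ≤ n → k ∈ range n
∈-range⁺ (s≤s _) k≤n = ∈-map⁺ suc (∈-upTo⁺ k≤n)

∈-range⁻ : ∀ {k n} → k ∈ range n → 1 ≤ k × k ≤ n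
∈-range⁻ k∈ with i , i∈ , refl ← ∈-map⁻ suc k∈ = s≤s z≤n , ∈-upTo⁻ i∈

Φ-suc : ∀ n → Φ (suc n) ≡ Φ n + φ (suc n)
Φ-suc n = begin
  sum (map φ⁺ (upTo (suc n)))             ≡⟨ cong (sum ∘ map φ⁺) (upTo-∷ʳ n) ⟨
  sum (map φ⁺ (upTo n ∷ʳ n))              ≡⟨ cong sum (map-++ φ⁺ (upTo n) (n ∷ [])) ⟩
  sum (map φ⁺ (upTo n) ++ φ⁺ n ∷ [])      ≡⟨ sum-++ (map φ⁺ (upTo n)) (φ⁺ n ∷ []) ⟩
  Φ n + (φ⁺ n + 0)                        ≡⟨ cong (ℕ._+_ (Φ n)) (ℕ.+-identityʳ (φ⁺ n)) ⟩
  Φ n + φ⁺ n                              ∎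
  where
  open ≡-Reasoning
  φ⁺ = φ ∘ suc

-- By `gcd≡1` the fraction is in lowest terms, so normalisation changes nothing. Together with
-- `↧-value` this recovers k and m from the rational.
↥-value : ∀ f → ↥ Fraction.value f ≡ + Fraction.k f
↥-value record { k = k ; m = suc _ ; gcd≡1 = g } = cong ↥_ (ℚ.normalize-coprime {k} (gcd≡1⇒coprime g))

↧-value : ∀ f → ↧ₙ Fraction.value f ≡ Fraction.m f
↧-value record { k = k ; m = suc _ ; gcd≡1 = g } = cong ↧ₙ_ (ℚ.normalize-coprime {k} (gcd≡1⇒coprime g))

value-pos : ∀ f → 0ℚ ℚ.< Fraction.value f
value-pos record { k = k ; m = m } = ℚ.positive⁻¹ (ℚ.normalize k m) {{ℚ.normalize-pos k m}}

value≤1 : ∀ f → Fraction.value f ℚ.≤ 1ℚ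
value≤1 f = ℚ.*≤* (begin
  ↥ v ℤ.* (+ 1)    ≡⟨ ℤ.*-identityʳ (↥ v) ⟩
  ↥ v              ≡⟨ ↥-value f ⟩
  + Fraction.k f   ≤⟨ ℤ.+≤+ (Fraction.k≤m f) ⟩
  + Fraction.m f   ≡⟨ cong +_ (↧-value f) ⟨
  + ↧ₙ v           ≡⟨ ℤ.*-identityˡ (+ ↧ₙ v) ⟨
  (+ 1) ℤ.* + ↧ₙ v ∎)
  where
  open ℤ.≤-Reasoning
  v = Fraction.value f

-- Including k = n makes 1 a totative of 1 and matches the condition 0 < k / n ≤ 1.
Totative : ℕ → Pred ℕ 0ℓ
Totative n k = (1 ≤ k × k ≤ n) × Coprime k n

totative-fraction : ∀ {n k} → 1 ≤ n → Totative n k → Fraction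
totative-fraction {n} {k} 1≤n ((1≤k , k≤n) , coprime) = record
  { k = k ; m = n ; gcd≡1 = coprime⇒gcd≡1 coprime ; k≤m = k≤n
  ; k≢0 = ℕ.>-nonZero 1≤k ; m≢0 = ℕ.>-nonZero 1≤n }

φ-cardinality : ∀ n → HasCardinality (Totative n) (φ n)
φ-cardinality n =
    filter coprime-n? (range n)
  , Unique.filter⁺ coprime-n? (Unique.map⁺ ℕ.suc-injective (Unique.upTo⁺ n))
  , (λ k → mk⇔ (map₁ ∈-range⁻ ∘ ∈-filter⁻ coprime-n? {xs = range n})
                (uncurry (∈-filter⁺ coprime-n?) ∘ map₁ (uncurry ∈-range⁺)))
  , refl
  where
  coprime-n? : Decidable (λ k → Coprime k n)
  coprime-n? k = coprime? k n

𝕀-cardinality : ∀ d → HasCardinality (𝕀 (suc d)) (φ (suc d))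
𝕀-cardinality d = cardinality-image (λ k → + k ℚ./ n) injective image (φ-cardinality n)
  where
  n = suc d

  injective : ∀ {k l} → Totative n k → Totative n l → + k ℚ./ n ≡ + l ℚ./ n → k ≡ l
  injective tₖ tₗ eq = ℤ.+-injective (trans (sym (↥-value (totative-fraction (s≤s z≤n) tₖ)))
    (trans (cong ↥_ eq) (↥-value (totative-fraction (s≤s z≤n) tₗ))))

  image : ∀ x → 𝕀 n x ⇔ (∃[ k ] Totative n k × + k ℚ./ n ≡ x)
  image x = mk⇔
    (λ { (record { k = k ; k≢0 = k≢0 ; gcd≡1 = g ; k≤m = k≤m } , eq , refl) →
         k , ((ℕ.>-nonZero⁻¹ k {{k≢0}} , k≤m) , gcd≡1⇒coprime g) , eq })
    (λ (k , t , eq) → totative-fraction (s≤s z≤n) t , eq , refl)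

𝕀-size : ∀ n → HasCardinality (InFirst 𝕀 n) (Φ n)
𝕀-size zero    = cardinality-∅ λ { _ (zero , () , _) ; _ (suc _ , _ , () , _) }
𝕀-size (suc n) = subst (HasCardinality _) (sym (Φ-suc n))
  (cardinality-⇔ (InFirst-suc n) (cardinality-∪ disjoint (𝕀-size n) (𝕀-cardinality n)))
  where
  disjoint : ∀ {x} → InFirst 𝕀 n x → 𝕀 (suc n) x → ⊥
  -- A rational has only one reduced denominator, which would be both at most n and equal to n + 1.
  disjoint (_ , _ , i≤n , f , refl , refl) (g , g≡f , m≡1+n) = ℕ.<⇒≢ (s≤s i≤n)
    (trans (sym (↧-value f)) (trans (cong ↧ₙ_ (sym g≡f)) (trans (↧-value g) m≡1+n)))

-- The size sequence of `ℚ±`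

ℕ⇒ℚ-mono-≤ : ∀ {m n} → m ≤ n → ℕ⇒ℚ m ℚ.≤ ℕ⇒ℚ n
ℕ⇒ℚ-mono-≤ {m} {n} m≤n = ℚ.*≤* (ℤ.*-monoʳ-≤-nonNeg (+ 1) (ℤ.+≤+ m≤n))

ℕ⇒ℚ-mono-< : ∀ {m n} → m < n → ℕ⇒ℚ m ℚ.< ℕ⇒ℚ n
ℕ⇒ℚ-mono-< {m} {n} m<n = ℚ.*<* (ℤ.*-monoʳ-<-pos (+ 1) (ℤ.+<+ m<n))

ℕ⇒ℚ-+ : ∀ m n → ℕ⇒ℚ (m + n) ≡ ℕ⇒ℚ m ℚ.+ ℕ⇒ℚ n
ℕ⇒ℚ-+ m n = ℚ.toℚᵘ-injective (ℚᵘ.≃-trans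
  (ℚᵘ.*≡* (cong (ℤ._* (+ 1)) (sym (cong₂ ℤ._+_ (ℤ.*-identityʳ (+ m)) (ℤ.*-identityʳ (+ n))))))
  (ℚᵘ.≃-sym (ℚ.toℚᵘ-homo-+ (ℕ⇒ℚ m) (ℕ⇒ℚ n))))

ℕ⇒ℚ-* : ∀ m n → ℕ⇒ℚ (m * n) ≡ ℕ⇒ℚ m ℚ.* ℕ⇒ℚ n
ℕ⇒ℚ-* m n = ℚ.toℚᵘ-injective (ℚᵘ.≃-trans
  (ℚᵘ.*≡* (cong (ℤ._* (+ 1)) (ℤ.pos-* m n)))
  (ℚᵘ.≃-sym (ℚ.toℚᵘ-homo-* (ℕ⇒ℚ m) (ℕ⇒ℚ n))))

-- p + y ≤ p + 1 ≤ q < q + x: the intervals (p, p + 1] for different p are disjoint.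
floor-unique : ∀ {p q x y} → 0ℚ ℚ.< x → y ℚ.≤ 1ℚ → p < q → ¬ (ℕ⇒ℚ p ℚ.+ y ≡ ℕ⇒ℚ q ℚ.+ x)
floor-unique {p} {q} {x} {y} 0<x y≤1 p<q = ℚ.<⇒≢ (begin-strict
  ℕ⇒ℚ p ℚ.+ y      ≤⟨ ℚ.+-monoʳ-≤ (ℕ⇒ℚ p) y≤1 ⟩
  ℕ⇒ℚ p ℚ.+ 1ℚ     ≡⟨ ℕ⇒ℚ-+ p 1 ⟨
  ℕ⇒ℚ (p + 1)      ≡⟨ cong ℕ⇒ℚ (ℕ.+-comm p 1) ⟩
  ℕ⇒ℚ (suc p)      ≤⟨ ℕ⇒ℚ-mono-≤ p<q ⟩
  ℕ⇒ℚ q            ≡⟨ ℚ.+-identityʳ (ℕ⇒ℚ q) ⟨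
  ℕ⇒ℚ q ℚ.+ 0ℚ     <⟨ ℚ.+-monoʳ-< (ℕ⇒ℚ q) 0<x ⟩
  ℕ⇒ℚ q ℚ.+ x      ∎)
  where open ℚ.≤-Reasoning

-- As n ≥ 1, the condition `ℓ p ⊔ m f ≤ n` says p ≤ n and m ≤ n separately. The first n components
-- thus form a rectangle: the n + 1 values 0, ..., n of p times the Φ(n) fractions with denominator
-- at most n.
ℚ⁺-size : ∀ n → 1 ≤ n → HasCardinality (InFirst ℚ⁺ n) (suc n * Φ n)
ℚ⁺-size n 1≤n = cardinality-image (λ (p , x) → ℕ⇒ℚ p ℚ.+ x) injective image
  (cardinality-× {𝒫 = _< suc n} below (𝕀-size n))
  where
  Pair : Pred (ℕ × ℚ) 0ℓ
  Pair (p , x) = p < suc n × InFirst 𝕀 n x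

  below : HasCardinality (_< suc n) (suc n)
  below = upTo (suc n) , Unique.upTo⁺ (suc n) , (λ p → mk⇔ ∈-upTo⁻ ∈-upTo⁺) , length-upTo (suc n)

  injective : ∀ {s t} → Pair s → Pair t →
              ℕ⇒ℚ (proj₁ s) ℚ.+ proj₂ s ≡ ℕ⇒ℚ (proj₁ t) ℚ.+ proj₂ t → s ≡ t
  injective {p , x} {q , y} (_ , _ , _ , _ , f , refl , _) (_ , _ , _ , _ , g , refl , _) eq
    with ℕ.<-cmp p q
  ... | tri< p<q _ _ = contradiction eq (floor-unique (value-pos g) (value≤1 f) p<q)
  ... | tri≈ _ refl _ = cong (p ,_) (∙-cancelˡ (ℕ⇒ℚ p) x y eq)
  ... | tri> _ _ q<p = contradiction (sym eq) (floor-unique (value-pos f) (value≤1 g) q<p)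

  p≤ℓp : ∀ p → p ≤ ℓ p
  p≤ℓp zero    = z≤n
  p≤ℓp (suc p) = ℕ.≤-refl

  ℓp≤n : ∀ {p} → p ≤ n → ℓ p ≤ n
  ℓp≤n {zero}  _   = 1≤n
  ℓp≤n {suc p} p≤n = p≤n

  image : ∀ q → InFirst ℚ⁺ n q ⇔ (∃[ s ] Pair s × ℕ⇒ℚ (proj₁ s) ℚ.+ proj₂ s ≡ q)
  image q = mk⇔
    (λ { (_ , _ , i≤n , p , f , eq , refl) →
         (p , Fraction.value f)
       , ( s≤s (ℕ.≤-trans (p≤ℓp p) (ℕ.m⊔n≤o⇒m≤o (ℓ p) (Fraction.m f) i≤n))
         , Fraction.m f , ℕ.>-nonZero⁻¹ _ {{Fraction.m≢0 f}}
         , ℕ.m⊔n≤o⇒n≤o (ℓ p) (Fraction.m f) i≤n , f , refl , refl)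
       , eq })
    (λ { ((p , _) , (s≤s p≤n , _ , 1≤i , i≤n , f , refl , refl) , eq) →
         ℓ p ⊔ Fraction.m f , ℕ.≤-trans 1≤i (ℕ.m≤n⊔m (ℓ p) (Fraction.m f))
       , ℕ.⊔-lub (ℓp≤n p≤n) i≤n , p , f , eq , refl })

ℚ⁺-pos : ∀ {n q} → InFirst ℚ⁺ n q → 0ℚ ℚ.< q
ℚ⁺-pos (_ , _ , _ , p , f , refl , _) =
  ℚ.+-mono-≤-< {0ℚ} {ℕ⇒ℚ p} (ℕ⇒ℚ-mono-≤ z≤n) (value-pos f)

ℚ±-size : ∀ n → 1 ≤ n → HasCardinality (InFirst ℚ± n) (2 * (n + 1) * Φ n + 1)
ℚ±-size n 1≤n = subst (HasCardinality _) count (cardinality-⇔ split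
  (cardinality-∪ disjoint (ℚ⁺-size n 1≤n)
    (cardinality-∪ disjoint⁻ negatives (cardinality-singleton 0ℚ))))
  where
  split : ∀ q → InFirst ℚ± n q ⇔ (InFirst ℚ⁺ n q ⊎ InFirst ℚ⁻ n q ⊎ q ≡ 0ℚ)
  split q = mk⇔
    (λ { (i , 1≤i , i≤n , inj₁ a)               → inj₁ (i , 1≤i , i≤n , a)
       ; (i , 1≤i , i≤n , inj₂ (inj₁ a))        → inj₂ (inj₁ (i , 1≤i , i≤n , a))
       ; (i , 1≤i , i≤n , inj₂ (inj₂ (a , _))) → inj₂ (inj₂ a) })
    (λ { (inj₁ (i , 1≤i , i≤n , a))        → i , 1≤i , i≤n , inj₁ a
       ; (inj₂ (inj₁ (i , 1≤i , i≤n , a))) → i , 1≤i , i≤n , inj₂ (inj₁ a)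
       ; (inj₂ (inj₂ a))                   → 1 , ℕ.≤-refl , 1≤n , inj₂ (inj₂ (a , refl)) })

  negatives : HasCardinality (InFirst ℚ⁻ n) (suc n * Φ n)
  negatives = cardinality-image ℚ.-_ (λ _ _ → ℚ.neg-injective)
    (λ q → mk⇔ (λ a → ℚ.- q , a , ⁻¹-involutive q)
               (λ { (x , a , refl) → subst (InFirst ℚ⁺ n) (sym (⁻¹-involutive x)) a }))
    (ℚ⁺-size n 1≤n)

  disjoint⁻ : ∀ {q} → InFirst ℚ⁻ n q → q ≡ 0ℚ → ⊥
  disjoint⁻ a refl = ℚ.<-irrefl refl (ℚ⁺-pos a)

  disjoint : ∀ {q} → InFirst ℚ⁺ n q → InFirst ℚ⁻ n q ⊎ q ≡ 0ℚ → ⊥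
  -- If q and -q were both positive, so would be their sum 0.
  disjoint {q} a (inj₁ b)    = ℚ.<-irrefl (sym (ℚ.+-inverseʳ q))
    (ℚ.+-mono-< (ℚ⁺-pos a) (ℚ⁺-pos b))
  disjoint     a (inj₂ refl) = ℚ.<-irrefl refl (ℚ⁺-pos a)

  count : suc n * Φ n + (suc n * Φ n + 1) ≡ 2 * (n + 1) * Φ n + 1
  count = regroup n (Φ n)
    where
    regroup : ∀ n s → suc n * s + (suc n * s + 1) ≡ 2 * (n + 1) * s + 1
    regroup = solve-∀

-- Sums over the gcds of the pairs a ≤ b ≤ n

∑ : List X → (X → ℕ) → ℕ
∑ xs f = sum (map f xs)

∑-++ : ∀ xs ys (f : X → ℕ) → ∑ (xs ++ ys) f ≡ ∑ xs f + ∑ ys f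
∑-++ xs ys f = trans (cong sum (map-++ f xs ys)) (sum-++ (map f xs) (map f ys))

∑-range-suc : ∀ n f → ∑ (range (suc n)) f ≡ ∑ (range n) f + f (suc n)
∑-range-suc n f = begin
  ∑ (range (suc n)) f            ≡⟨ cong (λ xs → ∑ xs f) (range-∷ʳ n) ⟨
  ∑ (range n ∷ʳ suc n) f         ≡⟨ ∑-++ (range n) (suc n ∷ []) f ⟩
  ∑ (range n) f + (f (suc n) + 0) ≡⟨ cong (ℕ._+_ (∑ (range n) f)) (ℕ.+-identityʳ _) ⟩
  ∑ (range n) f + f (suc n)      ∎
  where open ≡-Reasoning

∑-+ : ∀ xs (f g : X → ℕ) → ∑ xs (λ x → f x + g x) ≡ ∑ xs f + ∑ xs g
∑-+ []       f g = refl
∑-+ (x ∷ xs) f g = trans (cong (ℕ._+_ (f x + g x)) (∑-+ xs f g))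
  (exchange (f x) (g x) (∑ xs f) (∑ xs g))
  where
  exchange : ∀ a b c d → a + b + (c + d) ≡ a + c + (b + d)
  exchange = solve-∀

∑-*ˡ : ∀ c xs (f : X → ℕ) → ∑ xs (λ x → c * f x) ≡ c * ∑ xs f
∑-*ˡ c []       f = sym (ℕ.*-zeroʳ c)
∑-*ˡ c (x ∷ xs) f = trans (cong (ℕ._+_ (c * f x)) (∑-*ˡ c xs f)) (sym (ℕ.*-distribˡ-+ c (f x) _))

∑-const : ∀ c (xs : List X) → ∑ xs (λ _ → c) ≡ length xs * c
∑-const c []       = refl
∑-const c (x ∷ xs) = cong (ℕ._+_ c) (∑-const c xs)

∑-cong : ∀ xs {f g : X → ℕ} → (∀ {x} → x ∈ xs → f x ≡ g x) → ∑ xs f ≡ ∑ xs g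
∑-cong []       eq = refl
∑-cong (x ∷ xs) eq = cong₂ _+_ (eq (here refl)) (∑-cong xs (eq ∘ there))

∑-mono : ∀ xs {f g : X → ℕ} → (∀ {x} → x ∈ xs → f x ≤ g x) → ∑ xs f ≤ ∑ xs g
∑-mono []       le = z≤n
∑-mono (x ∷ xs) le = ℕ.+-mono-≤ (le (here refl)) (∑-mono xs (le ∘ there))

∑-∈ : ∀ {x} {xs : List X} (f : X → ℕ) → x ∈ xs → f x ≤ ∑ xs f
∑-∈ f (here refl) = ℕ.m≤m+n _ _
∑-∈ f (there x∈)  = ℕ.m≤n⇒m≤o+n _ (∑-∈ f x∈)

∑-swap : ∀ (xs : List X) (ys : List Y) (f : X → Y → ℕ) →
         ∑ xs (λ x → ∑ ys (f x)) ≡ ∑ ys (λ y → ∑ xs (λ x → f x y))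
∑-swap []       ys f = sym (trans (∑-const 0 ys) (ℕ.*-zeroʳ (length ys)))
∑-swap (x ∷ xs) ys f = trans (cong (ℕ._+_ (∑ ys (f x))) (∑-swap xs ys f)) (sym (∑-+ ys (f x) _))

-- Only `does a?` is inspected, so `gcd a b ≟ 1` and `coprime? a b` yield the same number by
-- computation, on which `Φ-∑` relies.
𝟏 : {A : Set} → Dec A → ℕ
𝟏 a? = if does a? then 1 else 0

𝟏-yes : {A : Set} (a? : Dec A) → A → 𝟏 a? ≡ 1
𝟏-yes a? a = cong (if_then 1 else 0) (dec-true a? a)

𝟏-no : {A : Set} (a? : Dec A) → ¬ A → 𝟏 a? ≡ 0
𝟏-no a? ¬a = cong (if_then 1 else 0) (dec-false a? ¬a)

𝟏-mono : {A B : Set} (a? : Dec A) (b? : Dec B) → (A → B) → 𝟏 a? ≤ 𝟏 b?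
𝟏-mono (yes a) b? f = ℕ.≤-reflexive (sym (𝟏-yes b? (f a)))
𝟏-mono (no _)  b? f = z≤n

length-filter-∑ : {P : Pred X 0ℓ} (P? : Decidable P) (xs : List X) →
                  length (filter P? xs) ≡ ∑ xs (λ x → 𝟏 (P? x))
length-filter-∑ P? []       = refl
length-filter-∑ P? (x ∷ xs) with P? x
... | yes _ = cong suc (length-filter-∑ P? xs)
... | no  _ = length-filter-∑ P? xs

-- Opaque so that m and g can be inferred from δ m g.
opaque
  δ : ℕ → ℕ → ℕ
  δ m g = 𝟏 (m ∣? g)

  δ-yes : ∀ {m g} → m ∣ g → δ m g ≡ 1
  δ-yes {m} {g} = 𝟏-yes (m ∣? g)

  δ-no : ∀ {m g} → ¬ m ∣ g → δ m g ≡ 0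
  δ-no {m} {g} = 𝟏-no (m ∣? g)

  δ-mono : ∀ {l m g h} → (m ∣ g → l ∣ h) → δ m g ≤ δ l h
  δ-mono {l} {m} {g} {h} = 𝟏-mono (m ∣? g) (l ∣? h)

-- Entries are kept with multiplicity, one per pair, so that an inequality between indicators of g
-- sums to an inequality between numbers of pairs.
gcds : ℕ → List ℕ
gcds zero    = []
gcds (suc n) = gcds n ++ map (λ a → gcd a (suc n)) (range (suc n))

∑-gcds-suc : ∀ n f → ∑ (gcds (suc n)) f ≡ ∑ (gcds n) f + ∑ (range (suc n)) (λ a → f (gcd a (suc n)))
∑-gcds-suc n f = trans (∑-++ (gcds n) _ f)
  (cong (λ xs → ∑ (gcds n) f + sum xs) (sym (map-∘ {g = f} {f = λ a → gcd a (suc n)} (range (suc n)))))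

∈-gcds : ∀ n {g} → g ∈ gcds n → 1 ≤ g × g ≤ n
∈-gcds (suc n) g∈ with ∈-++⁻ (gcds n) g∈
... | inj₁ g∈′ = let 1≤g , g≤n = ∈-gcds n g∈′ in 1≤g , ℕ.m≤n⇒m≤1+n g≤n
... | inj₂ g∈′ with a , _ , refl ← ∈-map⁻ (λ a → gcd a (suc n)) {xs = range (suc n)} g∈′ =
  ℕ.n≢0⇒n>0 (gcd[m,n]≢0 a (suc n) (inj₂ λ ())) , gcd[m,n]≤n a (suc n)

Φ-∑ : ∀ n → ∑ (gcds n) (λ g → 𝟏 (g ≟ 1)) ≡ Φ n
Φ-∑ zero    = refl
Φ-∑ (suc n) = begin
  ∑ (gcds (suc n)) (λ g → 𝟏 (g ≟ 1))  ≡⟨ ∑-gcds-suc n (λ g → 𝟏 (g ≟ 1)) ⟩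
  ∑ (gcds n) (λ g → 𝟏 (g ≟ 1)) + ∑ (range (suc n)) (λ a → 𝟏 (coprime? a (suc n)))
    ≡⟨ cong₂ _+_ (Φ-∑ n) (sym (length-filter-∑ (λ a → coprime? a (suc n)) (range (suc n)))) ⟩
  Φ n + φ (suc n)                     ≡⟨ Φ-suc n ⟨
  Φ (suc n)                           ∎
  where open ≡-Reasoning

tri : ℕ → ℕ
tri zero    = 0
tri (suc n) = tri n + suc n

2tri : ∀ n → 2 * tri n ≡ n * suc n
2tri zero    = refl
2tri (suc n) = begin
  2 * (tri n + suc n)     ≡⟨ ℕ.*-distribˡ-+ 2 (tri n) (suc n) ⟩
  2 * tri n + 2 * suc n   ≡⟨ cong (_+ 2 * suc n) (2tri n) ⟩
  n * suc n + 2 * suc n   ≡⟨ solve (n ∷ []) ⟩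
  suc n * suc (suc n)     ∎
  where open ≡-Reasoning

-- This is ⌊n/m⌋ as a count, the form in which it arises from the pairs (a, b) with fixed b.
multiples : ℕ → ℕ → ℕ
multiples m n = ∑ (range n) (δ m)

multiples-∣ : ∀ {m n} → m ∣ suc n → multiples m (suc n) ≡ suc (multiples m n)
multiples-∣ {m} {n} m∣ = trans (∑-range-suc n (δ m))
  (trans (cong (ℕ._+_ (multiples m n)) (δ-yes m∣)) (ℕ.+-comm _ 1))

multiples-∤ : ∀ {m n} → ¬ m ∣ suc n → multiples m (suc n) ≡ multiples m n
multiples-∤ {m} {n} m∤ = trans (∑-range-suc n (δ m))
  (trans (cong (ℕ._+_ (multiples m n)) (δ-no m∤)) (ℕ.+-identityʳ _))

-- The remainder is carried along with the count: it grows by one at each step and returns to 0 when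
-- a multiple of m is reached.
multiples-% : ∀ m .{{_ : NonZero m}} n → ∃[ r ] r < m × n ≡ r + multiples m n * m
multiples-% m zero = 0 , ℕ.>-nonZero⁻¹ m , refl
multiples-% m (suc n) with multiples-% m n
... | r , r<m , eq with m ∣? suc n
... | yes m∣ = 0 , ℕ.>-nonZero⁻¹ m , (begin
  suc n                          ≡⟨ cong suc eq ⟩
  -- As r < m and m divides 1 + r, a full block has been completed: 1 + r = m.
  suc r + multiples m n * m      ≡⟨ cong (_+ multiples m n * m) (ℕ.≤-antisym r<m (∣⇒≤ m∣1+r)) ⟩
  suc (multiples m n) * m        ≡⟨ cong (_* m) (multiples-∣ m∣) ⟨
  multiples m (suc n) * m        ∎)
  where
  open ≡-Reasoning
  m∣1+r : m ∣ suc r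
  m∣1+r = ∣m+n∣m⇒∣n (subst (m ∣_) (trans (cong suc eq) (ℕ.+-comm (suc r) _)) m∣) (n∣m*n (multiples m n))
... | no  m∤ = suc r , ℕ.≤∧≢⇒< r<m 1+r≢m , trans (cong suc eq)
    (cong (λ k → suc r + k * m) (sym (multiples-∤ m∤)))
  where
  1+r≢m : ¬ suc r ≡ m
  1+r≢m refl = m∤ (divides (suc (multiples m n)) (cong suc eq))

multiples-/ : ∀ m .{{_ : NonZero m}} n → multiples m n ≡ n / m
multiples-/ m n with r , r<m , eq ← multiples-% m n = sym (begin
  n / m                                ≡⟨ cong (_/ m) eq ⟩
  (r + multiples m n * m) / m          ≡⟨ +-distrib-/-∣ʳ r (n∣m*n (multiples m n)) ⟩
  r / m + multiples m n * m / m        ≡⟨ cong₂ _+_ (m<n⇒m/n≡0 r<m) (m*n/n≡m (multiples m n) m) ⟩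
  multiples m n                        ∎)
  where open ≡-Reasoning

-- Induction on the larger member b = n + 1 of the pair. If m ∤ b, no new gcd is a multiple of m. If
-- m ∣ b, then m ∣ gcd(a, b) exactly when m ∣ a, and the number of such a is the next increment of
-- the triangular number.
∑-gcds-δ : ∀ m n → ∑ (gcds n) (δ m) ≡ tri (multiples m n)
∑-gcds-δ m zero = refl
∑-gcds-δ m (suc n) = trans (∑-gcds-suc n (δ m)) (step (m ∣? suc n))
  where
  open ≡-Reasoning
  step : Dec (m ∣ suc n) →
         ∑ (gcds n) (δ m) + ∑ (range (suc n)) (λ a → δ m (gcd a (suc n))) ≡ tri (multiples m (suc n))
  step (yes m∣) = begin
    ∑ (gcds n) (δ m) + ∑ (range (suc n)) (λ a → δ m (gcd a (suc n)))
      ≡⟨ cong₂ _+_ (∑-gcds-δ m n) (∑-cong (range (suc n)) λ {a} _ → ℕ.≤-antisym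
           (δ-mono (λ m∣g → ∣-trans m∣g (gcd[m,n]∣m a (suc n))))
           (δ-mono (λ m∣a → gcd-greatest m∣a m∣))) ⟩
    tri (multiples m n) + multiples m (suc n)
      ≡⟨ cong (ℕ._+_ (tri (multiples m n))) (multiples-∣ m∣) ⟩
    tri (suc (multiples m n))
      ≡⟨ cong tri (multiples-∣ m∣) ⟨
    tri (multiples m (suc n)) ∎
  step (no m∤) = begin
    ∑ (gcds n) (δ m) + ∑ (range (suc n)) (λ a → δ m (gcd a (suc n)))
      ≡⟨ cong₂ _+_ (∑-gcds-δ m n) (∑-cong (range (suc n)) λ {a} _ →
           δ-no (λ m∣g → m∤ (∣-trans m∣g (gcd[m,n]∣n a (suc n))))) ⟩
    tri (multiples m n) + ∑ (range (suc n)) (λ _ → 0)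
      ≡⟨ cong (ℕ._+_ (tri (multiples m n))) (trans (∑-const 0 (range (suc n))) (ℕ.*-zeroʳ (length (range (suc n))))) ⟩
    tri (multiples m n) + 0
      ≡⟨ ℕ.+-identityʳ _ ⟩
    tri (multiples m n)
      ≡⟨ cong tri (multiples-∤ m∤) ⟨
    tri (multiples m (suc n)) ∎

-- The sieve

δ-antitone : ∀ {l m} g → l ∣ m → δ m g ≤ δ l g
δ-antitone g l∣m = δ-mono (∣-trans l∣m)

Rough : Pred ℕ 0ℓ
Rough m = 2 ≤ m × ¬ 2 ∣ m × ¬ 3 ∣ m

rough? : Decidable Rough
rough? m = 2 ≤? m ×-dec ¬? (2 ∣? m) ×-dec ¬? (3 ∣? m)

roughs : ℕ → List ℕ
roughs M = filter rough? (range M)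

-- 6m divides both 3g and 2g, hence their difference g.
2m,3m∣⇒6m∣ : ∀ m {g} → 2 * m ∣ g → 3 * m ∣ g → 6 * m ∣ g
2m,3m∣⇒6m∣ m {g} (divides a eq) (divides b eq′) = divides-difference
  (divides a (trans (cong (3 *_) eq) (solve (a ∷ m ∷ []))))
  (divides b (trans (cong (2 *_) eq′) (solve (b ∷ m ∷ []))))
  where
  divides-difference : 6 * m ∣ 3 * g → 6 * m ∣ 2 * g → 6 * m ∣ g
  divides-difference 3g 2g = ∣m+n∣m⇒∣n (subst (6 * m ∣_) (ℕ.+-comm g (2 * g)) 3g) 2g

-- Inclusion-exclusion without subtraction: `δ m g` - `δ (2 * m) g` - `δ (3 * m) g` + `δ (6 * m) g`
-- indicates that g is a multiple of m but not of 2m or 3m, so it is nonnegative.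
δ-2,3 : ∀ m g → δ (2 * m) g + δ (3 * m) g ≤ δ m g + δ (6 * m) g
δ-2,3 m g = go (2 * m ∣? g) (3 * m ∣? g)
  where
  open ℕ.≤-Reasoning
  go : Dec (2 * m ∣ g) → Dec (3 * m ∣ g) → δ (2 * m) g + δ (3 * m) g ≤ δ m g + δ (6 * m) g
  go (no 2∤) _ = begin
    δ (2 * m) g + δ (3 * m) g ≡⟨ cong (_+ δ (3 * m) g) (δ-no 2∤) ⟩
    δ (3 * m) g               ≤⟨ δ-antitone g (n∣m*n 3) ⟩
    δ m g                     ≤⟨ ℕ.m≤m+n _ _ ⟩
    δ m g + δ (6 * m) g       ∎
  go (yes 2∣) (no 3∤) = begin
    δ (2 * m) g + δ (3 * m) g ≡⟨ cong (ℕ._+_ (δ (2 * m) g)) (δ-no 3∤) ⟩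
    δ (2 * m) g + 0           ≤⟨ ℕ.+-mono-≤ (δ-antitone g (n∣m*n 2)) z≤n ⟩
    δ m g + δ (6 * m) g       ∎
  go (yes 2∣) (yes 3∣) = begin
    δ (2 * m) g + δ (3 * m) g ≡⟨ cong₂ _+_ (δ-yes 2∣) (δ-yes 3∣) ⟩
    2                         ≡⟨ cong₂ _+_ (δ-yes (∣-trans (n∣m*n 2) 2∣)) (δ-yes (2m,3m∣⇒6m∣ m 2∣ 3∣)) ⟨
    δ m g + δ (6 * m) g       ∎

module _ (M j : ℕ) where

  -- With the negative terms moved across, this bounds the indicator of "g is prime to 6". If 2 or 3
  -- divides g, that indicator is 0 and `δ-2,3` handles the rest. Otherwise every term for an even
  -- number or a multiple of 3 vanishes, the left side is 1, and g is 1, an entry of `roughs M`, or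
  -- M + i with 1 ≤ i ≤ j.
  sieve : ∀ g → 1 ≤ g → g ≤ M + j →
          δ 1 g + δ 6 g + ∑ (roughs M) (λ m → δ (2 * m) g + δ (3 * m) g) ≤
          𝟏 (g ≟ 1) + (δ 2 g + δ 3 g) + ∑ (roughs M) (λ m → δ m g + δ (6 * m) g)
            + ∑ (range j) (λ i → δ (M + i) g)
  sieve g 1≤g g≤M+j = go (2 ∣? g) (3 ∣? g)
    where
    open ℕ.≤-Reasoning
    L = roughs M
    S₋ = ∑ L (λ m → δ (2 * m) g + δ (3 * m) g)
    S₊ = ∑ L (λ m → δ m g + δ (6 * m) g)
    R  = ∑ (range j) (λ i → δ (M + i) g)

    divisible : δ 1 g + δ 6 g ≤ δ 2 g + δ 3 g →
                δ 1 g + δ 6 g + S₋ ≤ 𝟏 (g ≟ 1) + (δ 2 g + δ 3 g) + S₊ + R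
    divisible le = begin
      δ 1 g + δ 6 g + S₋                        ≤⟨ ℕ.+-mono-≤ le (∑-mono L λ {m} _ → δ-2,3 m g) ⟩
      δ 2 g + δ 3 g + S₊                        ≤⟨ ℕ.+-monoˡ-≤ S₊ (ℕ.m≤n+m _ (𝟏 (g ≟ 1))) ⟩
      𝟏 (g ≟ 1) + (δ 2 g + δ 3 g) + S₊          ≤⟨ ℕ.m≤m+n _ R ⟩
      𝟏 (g ≟ 1) + (δ 2 g + δ 3 g) + S₊ + R      ∎

    covered : ¬ 2 ∣ g → ¬ 3 ∣ g → 1 ≤ 𝟏 (g ≟ 1) + (δ 2 g + δ 3 g) + S₊ + R
    covered 2∤g 3∤g with g ≤? M
    ... | no g≰M  = begin
      1                                     ≡⟨ δ-yes (∣-reflexive M+i≡g) ⟨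
      δ (M + i) g                           ≤⟨ ∑-∈ (λ i → δ (M + i) g) i∈ ⟩
      R                                     ≤⟨ ℕ.m≤n+m R _ ⟩
      𝟏 (g ≟ 1) + (δ 2 g + δ 3 g) + S₊ + R  ∎
      where
      i = g ℕ.∸ M
      M+i≡g : M + i ≡ g
      M+i≡g = ℕ.m+[n∸m]≡n (ℕ.<⇒≤ (ℕ.≰⇒> g≰M))
      i∈ : i ∈ range j
      i∈ = ∈-range⁺ (ℕ.m<n⇒0<n∸m (ℕ.≰⇒> g≰M))
        (ℕ.+-cancelˡ-≤ M i j (subst (_≤ M + j) (sym M+i≡g) g≤M+j))
    ... | yes g≤M = begin
      1                                     ≤⟨ small (ℕ.m≤n⇒m<n∨m≡n 1≤g) ⟩
      𝟏 (g ≟ 1) + S₊                        ≤⟨ ℕ.+-monoˡ-≤ S₊ (ℕ.m≤m+n _ _) ⟩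
      𝟏 (g ≟ 1) + (δ 2 g + δ 3 g) + S₊      ≤⟨ ℕ.m≤m+n _ R ⟩
      𝟏 (g ≟ 1) + (δ 2 g + δ 3 g) + S₊ + R  ∎
      where
      small : 1 < g ⊎ 1 ≡ g → 1 ≤ 𝟏 (g ≟ 1) + S₊
      small (inj₂ 1≡g) = ℕ.m≤n⇒m≤n+o S₊ (ℕ.≤-reflexive (sym (𝟏-yes (g ≟ 1) (sym 1≡g))))
      small (inj₁ 1<g) = begin
        1                         ≡⟨ δ-yes ∣-refl ⟨
        δ g g                     ≤⟨ ℕ.m≤m+n (δ g g) (δ (6 * g) g) ⟩
        δ g g + δ (6 * g) g       ≤⟨ ∑-∈ (λ m → δ m g + δ (6 * m) g)
                                       (∈-filter⁺ rough? (∈-range⁺ 1≤g g≤M) (1<g , 2∤g , 3∤g)) ⟩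
        S₊                        ≤⟨ ℕ.m≤n+m S₊ _ ⟩
        𝟏 (g ≟ 1) + S₊            ∎

    go : Dec (2 ∣ g) → Dec (3 ∣ g) →
         δ 1 g + δ 6 g + S₋ ≤ 𝟏 (g ≟ 1) + (δ 2 g + δ 3 g) + S₊ + R
    go (yes 2∣g) _ = divisible (ℕ.+-mono-≤
      (ℕ.≤-reflexive (trans (δ-yes {1} (1∣ g)) (sym (δ-yes 2∣g)))) (δ-antitone g (divides 2 refl)))
    go (no 2∤g) (yes 3∣g) = divisible (begin
      δ 1 g + δ 6 g   ≡⟨ ℕ.+-comm (δ 1 g) (δ 6 g) ⟩
      δ 6 g + δ 1 g   ≤⟨ ℕ.+-mono-≤ (δ-antitone g (divides 3 refl))
                           (ℕ.≤-reflexive (trans (δ-yes {1} (1∣ g)) (sym (δ-yes 3∣g)))) ⟩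
      δ 2 g + δ 3 g   ∎)
    go (no 2∤g) (no 3∤g) = begin
      δ 1 g + δ 6 g + S₋                   ≡⟨ cong₂ _+_ (cong₂ _+_ (δ-yes {1} (1∣ g)) (δ-no (2∤g ∘ ∣-trans (divides 3 refl)))) S₋≡0 ⟩
      1                                    ≤⟨ covered 2∤g 3∤g ⟩
      𝟏 (g ≟ 1) + (δ 2 g + δ 3 g) + S₊ + R ∎
      where
      S₋≡0 : S₋ ≡ 0
      S₋≡0 = trans (∑-cong L λ {m} _ → cong₂ _+_
          (δ-no (2∤g ∘ ∣-trans (m∣m*n m))) (δ-no (3∤g ∘ ∣-trans (m∣m*n m))))
        (trans (∑-const 0 L) (ℕ.*-zeroʳ (length L)))

-- By `∑-gcds-δ`, the number of pairs a ≤ b ≤ n with m ∣ gcd(a, b).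
T : ℕ → ℕ → ℕ
T n m = tri (multiples m n)

∑-gcds-∑-δ : ∀ n (xs : List ℕ) (h : ℕ → ℕ) →
             ∑ (gcds n) (λ g → ∑ xs (λ m → δ (h m) g)) ≡ ∑ xs (λ m → T n (h m))
∑-gcds-∑-δ n xs h = trans (∑-swap (gcds n) xs (λ g m → δ (h m) g)) (∑-cong xs λ {m} _ → ∑-gcds-δ (h m) n)

∑-gcds-δ₂ : ∀ n k l → ∑ (gcds n) (λ g → δ k g + δ l g) ≡ T n k + T n l
∑-gcds-δ₂ n k l = trans (∑-+ (gcds n) (δ k) (δ l)) (cong₂ _+_ (∑-gcds-δ k n) (∑-gcds-δ l n))

∑-gcds-∑-δ₂ : ∀ n (xs : List ℕ) (h k : ℕ → ℕ) →
              ∑ (gcds n) (λ g → ∑ xs (λ m → δ (h m) g + δ (k m) g)) ≡ ∑ xs (λ m → T n (h m) + T n (k m))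
∑-gcds-∑-δ₂ n xs h k = trans (∑-swap (gcds n) xs (λ g m → δ (h m) g + δ (k m) g))
  (∑-cong xs λ {m} _ → ∑-gcds-δ₂ n (h m) (k m))

-- `sieve` summed over all pairs: after exchanging sums, each sum of a δ becomes a `T`, and the gcds
-- equal to 1 give Φ(n).
sieve-∑ : ∀ M j → let n = M + j in
          T n 1 + T n 6 + ∑ (roughs M) (λ m → T n (2 * m) + T n (3 * m)) ≤
          Φ n + (T n 2 + T n 3) + ∑ (roughs M) (λ m → T n m + T n (6 * m)) + ∑ (range j) (λ i → T n (M + i))
sieve-∑ M j = begin
  T n 1 + T n 6 + ∑ L (λ m → T n (2 * m) + T n (3 * m))
    ≡⟨ cong₂ _+_ (∑-gcds-δ₂ n 1 6) (∑-gcds-∑-δ₂ n L (2 *_) (3 *_)) ⟨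
  ∑ G (λ g → δ 1 g + δ 6 g) + ∑ G (λ g → ∑ L (λ m → δ (2 * m) g + δ (3 * m) g))
    ≡⟨ ∑-+ G _ _ ⟨
  ∑ G (λ g → δ 1 g + δ 6 g + ∑ L (λ m → δ (2 * m) g + δ (3 * m) g))
    ≤⟨ ∑-mono G (λ {g} g∈ → let 1≤g , g≤n = ∈-gcds n g∈ in sieve M j g 1≤g g≤n) ⟩
  ∑ G (λ g → 𝟏 (g ≟ 1) + (δ 2 g + δ 3 g) + ∑ L (λ m → δ m g + δ (6 * m) g) + ∑ (range j) (λ i → δ (M + i) g))
    ≡⟨ ∑-+ G _ _ ⟩
  ∑ G (λ g → 𝟏 (g ≟ 1) + (δ 2 g + δ 3 g) + ∑ L (λ m → δ m g + δ (6 * m) g)) + ∑ G (λ g → ∑ (range j) (λ i → δ (M + i) g))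
    ≡⟨ cong₂ _+_ (∑-+ G _ _) (∑-gcds-∑-δ n (range j) (ℕ._+_ M)) ⟩
  ∑ G (λ g → 𝟏 (g ≟ 1) + (δ 2 g + δ 3 g)) + ∑ G (λ g → ∑ L (λ m → δ m g + δ (6 * m) g)) + R
    ≡⟨ cong (_+ R) (cong₂ _+_ (∑-+ G _ _) (∑-gcds-∑-δ₂ n L id (6 *_))) ⟩
  ∑ G (λ g → 𝟏 (g ≟ 1)) + ∑ G (λ g → δ 2 g + δ 3 g) + ∑ L (λ m → T n m + T n (6 * m)) + R
    ≡⟨ cong (λ s → s + ∑ L (λ m → T n m + T n (6 * m)) + R) (cong₂ _+_ (Φ-∑ n) (∑-gcds-δ₂ n 2 3)) ⟩
  Φ n + (T n 2 + T n 3) + ∑ L (λ m → T n m + T n (6 * m)) + R ∎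
  where
  open ℕ.≤-Reasoning
  n = M + j
  G = gcds n
  L = roughs M
  R = ∑ (range j) (λ i → T n (M + i))

-- Estimates

/-unique : ∀ {x} k .{{_ : NonZero k}} r q → r < k → x ≡ r + q * k → x / k ≡ q
/-unique k r q r<k refl = trans (+-distrib-/-∣ʳ r (n∣m*n q)) (cong₂ _+_ (m<n⇒m/n≡0 r<k) (m*n/n≡m q k))

-- Doubling turns triangular numbers into products, so that the hypothesis is a polynomial identity
-- within reach of the ring solver.
tri-excess : ∀ {x a b c e} → 3 * (x * suc x + a * suc a) ≡ 3 * (b * suc b + c * suc c) + 2 * (x * x) + 2 * e →
             3 * (tri x + tri a) ≡ 3 * (tri b + tri c) + x * x + e
tri-excess {x} {a} {b} {c} {e} eq = ℕ.*-cancelˡ-≡ _ _ 2 (begin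
  2 * (3 * (tri x + tri a))                           ≡⟨ regroup (tri x) (tri a) ⟩
  3 * (2 * tri x + 2 * tri a)                         ≡⟨ cong (3 *_) (cong₂ _+_ (2tri x) (2tri a)) ⟩
  3 * (x * suc x + a * suc a)                         ≡⟨ eq ⟩
  3 * (b * suc b + c * suc c) + 2 * (x * x) + 2 * e   ≡⟨ cong (λ s → 3 * s + 2 * (x * x) + 2 * e) (cong₂ _+_ (2tri b) (2tri c)) ⟨
  3 * (2 * tri b + 2 * tri c) + 2 * (x * x) + 2 * e   ≡⟨ regroup′ (tri b) (tri c) (x * x) e ⟩
  2 * (3 * (tri b + tri c) + x * x + e)               ∎)
  where
  open ≡-Reasoning
  regroup : ∀ s t → 2 * (3 * (s + t)) ≡ 3 * (2 * s + 2 * t)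
  regroup = solve-∀
  regroup′ : ∀ s t u v → 3 * (2 * s + 2 * t) + 2 * u + 2 * v ≡ 2 * (3 * (s + t) + u + v)
  regroup′ = solve-∀

private
  bound : ∀ {e x y} k → x ≡ y → y ≡ e + k → e ≤ x
  bound {e} k refl refl = ℕ.m≤m+n e k

  excess : ∀ {x a b c a′ b′ c′ x′ e} → a ≡ a′ → b ≡ b′ → c ≡ c′ → x ≡ x′ →
    3 * (x′ * suc x′ + a′ * suc a′) ≡ 3 * (b′ * suc b′ + c′ * suc c′) + 2 * (x′ * x′) + 2 * e →
    3 * (tri x + tri a) ≡ 3 * (tri b + tri c) + x * x + e
  excess {x} {a} {b} {c} {e = e} refl refl refl refl = tri-excess {x} {a} {b} {c} {e}

-- The number of pairs a ≤ b ≤ x with gcd prime to 6 is x² / 3 + O(x).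
sieve-excess : ∀ x → ∃[ e ] e ≤ 3 * x ×
  3 * (tri x + tri (x / 6)) ≡ 3 * (tri (x / 2) + tri (x / 3)) + x * x + e
sieve-excess x with x divMod 6
-- With x = 6q + r, the three quotients are linear in q. The quadratic terms (3/2)(36 + 1 - 9 - 4)
-- q² = 36 q² are exactly those of x², so e is linear in q; the explicit argument of `bound` is 3x -
-- e.
... | result q zero eq = 3 * q + 0 , bound (15 * q + 0) (cong (3 *_) eq) (solve (q ∷ [])) , excess
  (/-unique 6 0 q (ℕ.<ᵇ⇒< _ _ _) eq)
  (/-unique 2 0 (0 + 3 * q) (ℕ.<ᵇ⇒< _ _ _) (trans eq (solve (q ∷ []))))
  (/-unique 3 0 (0 + 2 * q) (ℕ.<ᵇ⇒< _ _ _) (trans eq (solve (q ∷ []))))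
  eq (solve (q ∷ []))
... | result q (suc zero) eq = 9 * q + 2 , bound (9 * q + 1) (cong (3 *_) eq) (solve (q ∷ [])) , excess
  (/-unique 6 1 q (ℕ.<ᵇ⇒< _ _ _) eq)
  (/-unique 2 1 (0 + 3 * q) (ℕ.<ᵇ⇒< _ _ _) (trans eq (solve (q ∷ []))))
  (/-unique 3 1 (0 + 2 * q) (ℕ.<ᵇ⇒< _ _ _) (trans eq (solve (q ∷ []))))
  eq (solve (q ∷ []))
... | result q (suc (suc zero)) eq = 6 * q + 2 , bound (12 * q + 4) (cong (3 *_) eq) (solve (q ∷ [])) , excess
  (/-unique 6 2 q (ℕ.<ᵇ⇒< _ _ _) eq)
  (/-unique 2 0 (1 + 3 * q) (ℕ.<ᵇ⇒< _ _ _) (trans eq (solve (q ∷ []))))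
  (/-unique 3 2 (0 + 2 * q) (ℕ.<ᵇ⇒< _ _ _) (trans eq (solve (q ∷ []))))
  eq (solve (q ∷ []))
... | result q (suc (suc (suc zero))) eq = 6 * q + 3 , bound (12 * q + 6) (cong (3 *_) eq) (solve (q ∷ [])) , excess
  (/-unique 6 3 q (ℕ.<ᵇ⇒< _ _ _) eq)
  (/-unique 2 1 (1 + 3 * q) (ℕ.<ᵇ⇒< _ _ _) (trans eq (solve (q ∷ []))))
  (/-unique 3 0 (1 + 2 * q) (ℕ.<ᵇ⇒< _ _ _) (trans eq (solve (q ∷ []))))
  eq (solve (q ∷ []))
... | result q (suc (suc (suc (suc zero)))) eq = 3 * q + 2 , bound (15 * q + 10) (cong (3 *_) eq) (solve (q ∷ [])) , excess
  (/-unique 6 4 q (ℕ.<ᵇ⇒< _ _ _) eq)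
  (/-unique 2 0 (2 + 3 * q) (ℕ.<ᵇ⇒< _ _ _) (trans eq (solve (q ∷ []))))
  (/-unique 3 1 (1 + 2 * q) (ℕ.<ᵇ⇒< _ _ _) (trans eq (solve (q ∷ []))))
  eq (solve (q ∷ []))
... | result q (suc (suc (suc (suc (suc zero))))) eq = 9 * q + 8 , bound (9 * q + 7) (cong (3 *_) eq) (solve (q ∷ [])) , excess
  (/-unique 6 5 q (ℕ.<ᵇ⇒< _ _ _) eq)
  (/-unique 2 1 (2 + 3 * q) (ℕ.<ᵇ⇒< _ _ _) (trans eq (solve (q ∷ []))))
  (/-unique 3 2 (1 + 2 * q) (ℕ.<ᵇ⇒< _ _ _) (trans eq (solve (q ∷ []))))
  eq (solve (q ∷ []))

-- Asymptotically this loses a factor 2, which is affordable because it only serves for the tail m >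
-- M.
tri≤² : ∀ n → tri n ≤ n * n
tri≤² n = ℕ.*-cancelˡ-≤ 2 (begin
  2 * tri n       ≡⟨ 2tri n ⟩
  n * suc n       ≡⟨ ℕ.*-suc n n ⟩
  n + n * n       ≤⟨ ℕ.+-monoˡ-≤ (n * n) (n≤n² n) ⟩
  n * n + n * n   ≡⟨ cong (ℕ._+_ (n * n)) (ℕ.+-identityʳ (n * n)) ⟨
  2 * (n * n)     ∎)
  where
  open ℕ.≤-Reasoning
  n≤n² : ∀ n → n ≤ n * n
  n≤n² zero    = z≤n
  n≤n² (suc n) = ℕ.m≤m*n (suc n) (suc n)

multiples-≤ : ∀ m .{{_ : NonZero m}} n → m * multiples m n ≤ n
multiples-≤ m n = subst (_≤ n) (trans (ℕ.*-comm (n / m) m) (cong (m *_) (sym (multiples-/ m n)))) (m/n*n≤m n m)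

multiples-² : ∀ m .{{_ : NonZero m}} n → m * m * (multiples m n * multiples m n) ≤ n * n
multiples-² m n = subst (_≤ n * n) (ℕ.[m*n]*[o*p]≡[m*o]*[n*p] m x m x)
  (ℕ.*-mono-≤ (multiples-≤ m n) (multiples-≤ m n))
  where x = multiples m n

T-≤ : ∀ n m .{{_ : NonZero m}} → m * m * T n m ≤ n * n
T-≤ n m = ℕ.≤-trans (ℕ.*-monoʳ-≤ (m * m) (tri≤² (multiples m n))) (multiples-² m n)

-- Telescoping from 1 / k² ≤ 1 / (k - 1) - 1 / k.
tail-≤ : ∀ M .{{_ : NonZero M}} {Q} (t : ℕ → ℕ) j →
         (∀ i → (M + i) * (M + i) * t i ≤ Q) →
         M * (M + j) * ∑ (range j) t ≤ Q * j
tail-≤ M t zero    t≤ = ℕ.≤-trans (ℕ.≤-reflexive (ℕ.*-zeroʳ (M * (M + 0)))) z≤n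
-- The induction carries the exact telescoped value 1/M - 1/(M + j) = j / (M (M + j)), cleared of
-- denominators.
tail-≤ M {Q} t (suc j) t≤ = ℕ.*-cancelˡ-≤ K (begin
  K * (M * (M + suc j) * ∑ (range (suc j)) t)
    ≡⟨ cong₂ (λ k s → K * (M * k * s)) (ℕ.+-suc M j) (∑-range-suc j t) ⟩
  K * (M * suc K * (S + t (suc j)))
    ≡⟨ expand K M S (t (suc j)) ⟩
  suc K * (M * K * S) + M * (K * suc K * t (suc j))
    ≤⟨ ℕ.+-mono-≤ (ℕ.*-monoʳ-≤ (suc K) (tail-≤ M t j t≤)) (ℕ.*-monoʳ-≤ M last) ⟩
  suc K * (Q * j) + M * Q
    ≡⟨ collect M j Q ⟩
  K * (Q * suc j) ∎)
  where
  open ℕ.≤-Reasoning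
  K = M + j
  S = ∑ (range j) t
  instance
    K≢0 : NonZero K
    K≢0 = ℕ.>-nonZero (ℕ.≤-trans (ℕ.>-nonZero⁻¹ M) (ℕ.m≤m+n M j))

  last : K * suc K * t (suc j) ≤ Q
  last = ℕ.≤-trans (ℕ.*-monoˡ-≤ (t (suc j)) (ℕ.*-monoˡ-≤ (suc K) (ℕ.n≤1+n K)))
    (subst (λ k → k * k * t (suc j) ≤ Q) (ℕ.+-suc M j) (t≤ (suc j)))

  expand : ∀ k m s u → k * (m * suc k * (s + u)) ≡ suc k * (m * k * s) + m * (k * suc k * u)
  expand = solve-∀
  collect : ∀ m j q → suc (m + j) * (q * j) + m * q ≡ (m + j) * (q * suc j)
  collect = solve-∀

multiples-* : ∀ k m .{{_ : NonZero k}} .{{_ : NonZero m}} n → multiples (k * m) n ≡ multiples m n / k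
multiples-* k m n = begin
  multiples (k * m) n   ≡⟨ multiples-/ (k * m) n ⟩
  n / (k * m)           ≡⟨ /-congʳ (ℕ.*-comm k m) ⟩
  n / (m * k)           ≡⟨ m/n/o≡m/[n*o] n m k ⟨
  n / m / k             ≡⟨ cong (_/ k) (multiples-/ m n) ⟨
  multiples m n / k     ∎
  where
  open ≡-Reasoning
  instance
    _ = ℕ.m*n≢0 k m
    _ = ℕ.m*n≢0 m k

-- Nested floors collapse, ⌊n/(km)⌋ = ⌊⌊n/m⌋/k⌋, so this is `sieve-excess` at x = ⌊n/m⌋.
T-excess : ∀ n m .{{_ : NonZero m}} → ∃[ e ] e ≤ 3 * multiples m n ×
  3 * (T n m + T n (6 * m)) ≡ 3 * (T n (2 * m) + T n (3 * m)) + multiples m n * multiples m n + e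
T-excess n m rewrite multiples-* 2 m n | multiples-* 3 m n | multiples-* 6 m n = sieve-excess (multiples m n)

-- The case m = 1, keeping only e ≥ 0: at least n²/3 pairs have a gcd prime to 6.
T-lower : ∀ n → 3 * (T n 2 + T n 3) + n * n ≤ 3 * (T n 1 + T n 6)
T-lower n with e , _ , eq ← T-excess n 1 = ℕ.m+n≤o⇒m≤o _ {e} (ℕ.≤-reflexive
  (trans (cong (λ x → 3 * (T n 2 + T n 3) + x * x + e) (sym (trans (multiples-/ 1 n) (n/1≡n n)))) (sym eq)))

-- The lower bound for Φ

module _ (B : ℕ) where

  -- weight m / B is an upper bound for 1 / (3 m²), which keeps the numerals small.
  weight : ℕ → ℕ
  weight zero        = 0
  weight m@(suc _) = suc (B / (3 * (m * m)))

  weight-≥ : ∀ m .{{_ : NonZero m}} → B ≤ 3 * weight m * (m * m)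
  weight-≥ m@(suc _) = begin
    B                                    ≡⟨ m≡m%n+[m/n]*n B d ⟩
    B % d + B / d * d                    ≤⟨ ℕ.+-monoˡ-≤ _ (ℕ.<⇒≤ (m%n<n B d)) ⟩
    d + B / d * d                        ≡⟨ regroup (B / d) (m * m) ⟩
    3 * weight m * (m * m)               ∎
    where
    open ℕ.≤-Reasoning
    d = 3 * (m * m)
    regroup : ∀ w s → 3 * s + w * (3 * s) ≡ 3 * suc w * s
    regroup = solve-∀

  -- By `T-excess` the signed count for m is at most x²/3 + x with x = ⌊n/m⌋, hence at most n²/(3m²)
  -- + n. Scaling by B lets `weight m` replace B / (3m²).
  T-upper : ∀ n m .{{_ : NonZero m}} →
    B * (T n m + T n (6 * m)) ≤ B * (T n (2 * m) + T n (3 * m)) + (weight m * (n * n) + B * n)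
  T-upper n m with e , e≤ , eq ← T-excess n m = ℕ.*-cancelˡ-≤ 3 (begin
    3 * (B * P)                               ≡⟨ swap B P ⟩
    B * (3 * P)                               ≡⟨ cong (B *_) eq ⟩
    B * (3 * N + x * x + e)                   ≤⟨ ℕ.*-monoʳ-≤ B (ℕ.+-monoʳ-≤ (3 * N + x * x) (ℕ.≤-trans e≤ (ℕ.*-monoʳ-≤ 3 x≤n))) ⟩
    B * (3 * N + x * x + 3 * n)               ≡⟨ distribute B N (x * x) n ⟩
    3 * (B * N) + B * (x * x) + 3 * (B * n)   ≤⟨ ℕ.+-monoˡ-≤ _ (ℕ.+-monoʳ-≤ (3 * (B * N)) Bx²≤) ⟩
    3 * (B * N) + 3 * w * (n * n) + 3 * (B * n) ≡⟨ collect B N w (n * n) n ⟩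
    3 * (B * N + (w * (n * n) + B * n))       ∎)
    where
    open ℕ.≤-Reasoning
    x = multiples m n
    w = weight m
    P = T n m + T n (6 * m)
    N = T n (2 * m) + T n (3 * m)

    x≤n : x ≤ n
    x≤n = ℕ.≤-trans (ℕ.m≤n*m x m) (multiples-≤ m n)

    Bx²≤ : B * (x * x) ≤ 3 * w * (n * n)
    Bx²≤ = begin
      B * (x * x)                   ≤⟨ ℕ.*-monoˡ-≤ (x * x) (weight-≥ m) ⟩
      3 * w * (m * m) * (x * x)     ≡⟨ ℕ.*-assoc (3 * w) (m * m) (x * x) ⟩
      3 * w * (m * m * (x * x))     ≤⟨ ℕ.*-monoʳ-≤ (3 * w) (multiples-² m n) ⟩
      3 * w * (n * n)               ∎

    swap : ∀ b p → 3 * (b * p) ≡ b * (3 * p)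
    swap = solve-∀
    distribute : ∀ b p s n → b * (3 * p + s + 3 * n) ≡ 3 * (b * p) + b * s + 3 * (b * n)
    distribute = solve-∀
    collect : ∀ b p w s n → 3 * (b * p) + 3 * w * s + 3 * (b * n) ≡ 3 * (b * p + (w * s + b * n))
    collect = solve-∀

  module _ (M : ℕ) .{{_ : NonZero M}} where

    -- W / B bounds (1/3) Σ 1/m² over the rough m ≤ M from above.
    W : ℕ
    W = ∑ (roughs M) weight

    ∑-T-upper : ∀ n →
      B * ∑ (roughs M) (λ m → T n m + T n (6 * m)) ≤
      B * ∑ (roughs M) (λ m → T n (2 * m) + T n (3 * m)) + (W * (n * n) + length (roughs M) * (B * n))
    ∑-T-upper n = begin
      B * ∑ L P                                           ≡⟨ ∑-*ˡ B L P ⟨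
      ∑ L (λ m → B * P m)                                 ≤⟨ ∑-mono L (λ {m} m∈ → T-upper n m {{positive m∈}}) ⟩
      ∑ L (λ m → B * N m + (weight m * (n * n) + B * n))  ≡⟨ ∑-+ L _ _ ⟩
      ∑ L (λ m → B * N m) + ∑ L (λ m → weight m * (n * n) + B * n)
        ≡⟨ cong₂ _+_ (∑-*ˡ B L N) (trans (∑-+ L _ _) (cong₂ _+_ (∑-*ʳ L) (∑-const (B * n) L))) ⟩
      B * ∑ L N + (W * (n * n) + length L * (B * n))      ∎
      where
      open ℕ.≤-Reasoning
      L = roughs M
      P N : ℕ → ℕ
      P m = T n m + T n (6 * m)
      N m = T n (2 * m) + T n (3 * m)

      positive : ∀ {m} → m ∈ L → NonZero m
      positive m∈ = ℕ.>-nonZero (proj₁ (∈-range⁻ (proj₁ (∈-filter⁻ rough? {xs = range M} m∈))))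

      ∑-*ʳ : ∀ xs → ∑ xs (λ m → weight m * (n * n)) ≡ ∑ xs weight * (n * n)
      ∑-*ʳ []       = refl
      ∑-*ʳ (x ∷ xs) = trans (cong (ℕ._+_ (weight x * (n * n))) (∑-*ʳ xs)) (sym (ℕ.*-distribʳ-+ (n * n) (weight x) _))

    -- `tail-≤` with Q = n², followed by j ≤ n: the tail is at most n²/M.
    tail : ∀ j → let n = M + j in M * ∑ (range j) (λ i → T n (M + i)) ≤ n * n
    tail j = ℕ.*-cancelˡ-≤ n (begin
      n * (M * S)     ≡⟨ rearrange n M S ⟩
      M * n * S       ≤⟨ tail-≤ M (λ i → T n (M + i)) j (λ i → T-≤ n (M + i) {{M+i≢0 i}}) ⟩
      n * n * j       ≤⟨ ℕ.*-monoʳ-≤ (n * n) (ℕ.m≤n+m j M) ⟩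
      n * n * n       ≡⟨ ℕ.*-comm (n * n) n ⟩
      n * (n * n)     ∎)
      where
      open ℕ.≤-Reasoning
      n = M + j
      S = ∑ (range j) (λ i → T n (M + i))
      rearrange : ∀ n m s → n * (m * s) ≡ m * n * s
      rearrange = solve-∀
      M+i≢0 : ∀ i → NonZero (M + i)
      M+i≢0 i = ℕ.>-nonZero (ℕ.≤-trans (ℕ.>-nonZero⁻¹ M) (ℕ.m≤m+n M i))
      instance
        _ = M+i≢0 j

    -- This is n²/3 ≤ Φ(n) + (W/B) n² + l n + n²/M multiplied by 3MB, where l is the number of rough
    -- m ≤ M.
    Φ-lower : ∀ j → let n = M + j in
      M * B * (n * n) ≤ 3 * (M * B) * Φ n + 3 * M * W * (n * n) + 3 * (M * length (roughs M) * B * n) + 3 * B * (n * n)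
    -- `q` and `N` collect the counts that enter negatively, those for 2, 3 and for 2m, 3m; they
    -- stand on both sides and cancel at the end.
    Φ-lower j = ℕ.+-cancelˡ-≤ (3 * (M * (B * (q + N)))) _ _ (begin
      3 * (M * (B * (q + N))) + M * B * (n * n)
        ≡⟨ step₁ M B q N (n * n) ⟩
      M * B * (3 * q + n * n + 3 * N)
        ≤⟨ ℕ.*-monoʳ-≤ (M * B) (ℕ.+-monoˡ-≤ (3 * N) (T-lower n)) ⟩
      M * B * (3 * p + 3 * N)
        ≡⟨ step₂ (M * B) p N ⟩
      3 * (M * B) * (p + N)
        ≤⟨ ℕ.*-monoʳ-≤ (3 * (M * B)) (sieve-∑ M j) ⟩
      3 * (M * B) * (Φ n + q + P + S)
        ≡⟨ step₃ M B (Φ n) q P S ⟩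
      3 * (M * B) * Φ n + 3 * (M * B) * q + 3 * M * (B * P) + 3 * B * (M * S)
        ≤⟨ ℕ.+-mono-≤ (ℕ.+-monoʳ-≤ (3 * (M * B) * Φ n + 3 * (M * B) * q) (ℕ.*-monoʳ-≤ (3 * M) (∑-T-upper n)))
             (ℕ.*-monoʳ-≤ (3 * B) (tail j)) ⟩
      3 * (M * B) * Φ n + 3 * (M * B) * q + 3 * M * (B * N + (W * (n * n) + l * (B * n))) + 3 * B * (n * n)
        ≡⟨ step₄ M B (Φ n) q N W (n * n) l n ⟩
      3 * (M * (B * (q + N))) + (3 * (M * B) * Φ n + 3 * M * W * (n * n) + 3 * (M * l * B * n) + 3 * B * (n * n)) ∎)
      where
      open ℕ.≤-Reasoning
      n = M + j
      l = length (roughs M)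
      p = T n 1 + T n 6
      q = T n 2 + T n 3
      P = ∑ (roughs M) (λ m → T n m + T n (6 * m))
      N = ∑ (roughs M) (λ m → T n (2 * m) + T n (3 * m))
      S = ∑ (range j) (λ i → T n (M + i))
      step₁ : ∀ m b q r s → 3 * (m * (b * (q + r))) + m * b * s ≡ m * b * (3 * q + s + 3 * r)
      step₁ = solve-∀
      step₂ : ∀ c p r → c * (3 * p + 3 * r) ≡ 3 * c * (p + r)
      step₂ = solve-∀
      step₃ : ∀ m b f q p s → 3 * (m * b) * (f + q + p + s) ≡ 3 * (m * b) * f + 3 * (m * b) * q + 3 * m * (b * p) + 3 * b * (m * s)
      step₃ = solve-∀
      step₄ : ∀ m b f q r w s l n →
        3 * (m * b) * f + 3 * (m * b) * q + 3 * m * (b * r + (w * s + l * (b * n))) + 3 * b * s ≡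
        3 * (m * (b * (q + r))) + (3 * (m * b) * f + 3 * m * w * s + 3 * (m * l * b * n) + 3 * b * s)
      step₄ = solve-∀

-- Divided by 30MB, `budget` reads 1/3 = 3/10 + W/B + 1/M + c/(30MB). The surplus c n² absorbs the
-- linear error as soon as `large` holds.
Φ-lower-eventually : ∀ {B M c n} .{{_ : NonZero M}} .{{_ : NonZero B}} →
  10 * (M * B) ≡ 9 * (M * B) + 30 * (M * W B M) + 30 * B + c →
  30 * (M * length (roughs M) * B) ≤ c * n → M ≤ n →
  3 * (n * n) ≤ 10 * Φ n
Φ-lower-eventually {B} {M} {c} {n} budget large M≤n = ℕ.*-cancelˡ-≤ (3 * (M * B)) (ℕ.+-cancelʳ-≤ slack _ _ (begin
  3 * (M * B) * (3 * (n * n)) + slack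
    ≡⟨ step₁ (M * B) (M * W B M) B c (n * n) ⟩
  (9 * (M * B) + 30 * (M * W B M) + 30 * B + c) * (n * n)
    ≡⟨ cong (_* (n * n)) budget ⟨
  10 * (M * B) * (n * n)
    ≡⟨ ℕ.*-assoc 10 (M * B) (n * n) ⟩
  10 * (M * B * (n * n))
    ≤⟨ ℕ.*-monoʳ-≤ 10 (subst Bound (ℕ.m+[n∸m]≡n M≤n) (Φ-lower B M (n ℕ.∸ M))) ⟩
  10 * (3 * (M * B) * Φ n + 3 * M * W B M * (n * n) + 3 * (M * l * B * n) + 3 * B * (n * n))
    ≡⟨ step₂ (M * B) (Φ n) M (W B M) (n * n) (M * l * B) n B ⟩
  3 * (M * B) * (10 * Φ n) + (30 * (M * W B M) + 30 * B) * (n * n) + 30 * (M * l * B) * n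
    ≤⟨ ℕ.+-monoʳ-≤ _ (ℕ.*-monoˡ-≤ n large) ⟩
  3 * (M * B) * (10 * Φ n) + (30 * (M * W B M) + 30 * B) * (n * n) + c * n * n
    ≡⟨ step₃ (3 * (M * B) * (10 * Φ n)) (30 * (M * W B M) + 30 * B) c n ⟩
  3 * (M * B) * (10 * Φ n) + slack ∎))
  where
  open ℕ.≤-Reasoning
  l = length (roughs M)
  slack = (30 * (M * W B M) + 30 * B + c) * (n * n)
  instance
    _ = ℕ.m*n≢0 M B
    _ = ℕ.m*n≢0 3 (M * B)
  Bound : ℕ → Set
  Bound k = M * B * (k * k) ≤ 3 * (M * B) * Φ k + 3 * M * W B M * (k * k) + 3 * (M * l * B * k) + 3 * B * (k * k)
  step₁ : ∀ a w b c s → 3 * a * (3 * s) + (30 * w + 30 * b + c) * s ≡ (9 * a + 30 * w + 30 * b + c) * s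
  step₁ = solve-∀
  step₂ : ∀ a f m w s k n b → 10 * (3 * a * f + 3 * m * w * s + 3 * (k * n) + 3 * b * s) ≡
                            3 * a * (10 * f) + (30 * (m * w) + 30 * b) * s + 30 * k * n
  step₂ = solve-∀
  step₃ : ∀ a b c n → a + b * (n * n) + c * n * n ≡ a + (b + c) * (n * n)
  step₃ = solve-∀

-- A round value for `large`: 499 numbers up to 1500 are rough, and 30 · 1500 · 499 · 10⁷ /
-- 228945000 is about 980803.
threshold : ℕ
threshold = 1000000

-- With B = 10⁷ and M = 1500 the numeral 228945000 is the surplus in budget.
Φ-≥ : ∀ n → threshold ≤ n → 3 * (n * n) ≤ 10 * Φ n
Φ-≥ n N≤n = Φ-lower-eventually {10000000} {1500} {228945000} refl
  (ℕ.≤-trans (ℕ.≤ᵇ⇒≤ _ (228945000 * threshold) _) (ℕ.*-monoʳ-≤ 228945000 N≤n))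
  (ℕ.≤-trans (ℕ.≤ᵇ⇒≤ 1500 threshold _) N≤n)

-- The upper bound for Φ

φ-≤ : ∀ n → 1 ≤ n → φ (suc n) ≤ n
φ-≤ n 1≤n = ℕ.≤-pred (subst (φ (suc n) <_) (trans (length-map suc (upTo (suc n))) (length-upTo (suc n)))
  (filter-notAll (λ k → coprime? k (suc n)) (range (suc n))
    -- The filter drops n + 1 itself, which would be coprime to itself only if it were 1.
    (lose (∈-range⁺ (s≤s z≤n) ℕ.≤-refl)
      λ coprime → ℕ.<⇒≢ (s≤s 1≤n) (sym (coprime (∣-refl , ∣-refl))))))

-- Induction from 2Φ(6) = 24 < 30, the first strict case (2Φ(5) = 20 = 5 · 4). Passing from k to k +
-- 1 adds at most 2k on the left and exactly 2k on the right.
Φ-≤ : ∀ n → 5 ≤ n → 2 * Φ (suc n) < suc n * n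
Φ-≤ n 5≤n = subst (λ k → 2 * Φ (suc k) < suc k * k) (ℕ.m+[n∸m]≡n 5≤n) (go (n ℕ.∸ 5))
  where
  open ℕ.≤-Reasoning
  pronic : ∀ i → suc i * i + 2 * suc i ≡ suc (suc i) * suc i
  pronic = solve-∀

  go : ∀ j → 2 * Φ (6 + j) < (6 + j) * (5 + j)
  go zero    = ℕ.<ᵇ⇒< 24 30 _
  go (suc j) = subst (λ k → 2 * Φ (suc k) < suc k * k) (sym (ℕ.+-suc 5 j)) (begin-strict
    2 * Φ (suc k)              ≡⟨ cong (2 *_) (Φ-suc k) ⟩
    2 * (Φ k + φ (suc k))      ≡⟨ ℕ.*-distribˡ-+ 2 (Φ k) (φ (suc k)) ⟩
    2 * Φ k + 2 * φ (suc k)    <⟨ ℕ.+-mono-<-≤ (go j) (ℕ.*-monoʳ-≤ 2 (φ-≤ k (s≤s z≤n))) ⟩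
    k * (5 + j) + 2 * k        ≡⟨ pronic (5 + j) ⟩
    suc k * k                  ∎)
    where k = 6 + j

-- Bounds for the size sequence of ℚ

size : ℕ → ℕ
size n = 2 * (n + 1) * Φ n + 1

size-< : ∀ n → 6 ≤ n → size n + n < n ^ 3
size-< (suc k) (s≤s 5≤k) = begin-strict
  -- With n = k + 1, strictness in `Φ-≤` is worth n + 1 after multiplication by n + 1. Padding by k
  -- and then by 1 uses this up and completes the factor 2Φ(n) + 1.
  size (suc k) + suc k             ≤⟨ ℕ.m≤m+n _ k ⟩
  size (suc k) + suc k + k         <⟨ ℕ.n<1+n _ ⟩
  suc (size (suc k) + suc k + k)   ≡⟨ regroup (Φ (suc k)) k ⟩
  (2 + k) * suc (2 * Φ (suc k)) + suc k ≤⟨ ℕ.+-monoˡ-≤ (suc k) (ℕ.*-monoʳ-≤ (2 + k) (Φ-≤ k 5≤k)) ⟩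
  (2 + k) * (suc k * k) + suc k    ≡⟨ cube k ⟩
  suc k ^ 3                        ∎
  where
  open ℕ.≤-Reasoning
  regroup : ∀ f k → suc (2 * (suc k + 1) * f + 1 + suc k + k) ≡ (2 + k) * suc (2 * f) + suc k
  regroup = solve-∀
  cube : ∀ k → (2 + k) * (suc k * k) + suc k ≡ suc k * (suc k * (suc k * 1))
  cube = solve-∀

-- n³ + n² = (n + 1) n² reduces this to `Φ-≥`; strictness comes from the element 0, the summand 1 in
-- `size`.
size-> : ∀ n → threshold ≤ n → 3 * (n ^ 3 + n ^ 2) < 5 * size n
size-> n N≤n = begin-strict
  3 * (n ^ 3 + n ^ 2)             ≡⟨ factor n ⟩
  (n + 1) * (3 * (n * n))         ≤⟨ ℕ.*-monoʳ-≤ (n + 1) (Φ-≥ n N≤n) ⟩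
  (n + 1) * (10 * Φ n)            <⟨ ℕ.m<m+n _ (s≤s z≤n) ⟩
  (n + 1) * (10 * Φ n) + 5        ≡⟨ regroup n (Φ n) ⟩
  5 * size n                      ∎
  where
  open ℕ.≤-Reasoning
  factor : ∀ n → 3 * (n * (n * (n * 1)) + n * (n * 1)) ≡ (n + 1) * (3 * (n * n))
  factor = solve-∀
  regroup : ∀ n f → (n + 1) * (10 * f) + 5 ≡ 5 * (2 * (n + 1) * f + 1)
  regroup = solve-∀

theorem12 : ∃[ σ𝕀 ] ∃[ σℚ ]
    IsSizeSequence 𝕀 σ𝕀
    × IsSizeSequence ℚ± σℚ
    × (∀ n → 1 ≤ n → σℚ n ≡ 2 * σ𝕀 n * (n + 1) + 1)
    × (∀ n → 1 ≤ n → σℚ n ≡ 2 * (n + 1) * Φ n + 1)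
    × (ℕ⇒ℚ ∘ σℚ) ≈F (λ n → ℕ⇒ℚ (n ^ 3))
    × (λ n → (+ 3 ℚ./ 5) ℚ.* (ℕ⇒ℚ (n ^ 3) ℚ.+ ℕ⇒ℚ (n ^ 2))) <F (ℕ⇒ℚ ∘ σℚ)
    × (ℕ⇒ℚ ∘ σℚ) <F (λ n → ℕ⇒ℚ (n ^ 3) ℚ.- ℕ⇒ℚ n)
theorem12 =
    Φ , size , (λ n _ → 𝕀-size n) , ℚ±-size
  , (λ n _ → swap n (Φ n)) , (λ _ _ → refl)
  -- For large n, n³ is below 5/3 of the size, so the integer constant 2 serves; in the other
  -- direction 1 does.
  , ( (2 , s≤s z≤n , threshold , λ n N≤n → subst (ℕ⇒ℚ (n ^ 3) ℚ.≤_) (ℕ⇒ℚ-* 2 (size n)) (ℕ⇒ℚ-mono-≤ (cube≤ n N≤n)))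
    , (1 , s≤s z≤n , 6 , λ n 6≤n → subst (ℕ⇒ℚ (size n) ℚ.≤_) (sym (ℚ.*-identityˡ (ℕ⇒ℚ (n ^ 3))))
        (ℕ⇒ℚ-mono-≤ (ℕ.≤-trans (ℕ.m≤m+n (size n) n) (ℕ.<⇒≤ (size-< n 6≤n))))))
  , (threshold , lower) , (6 , upper)
  where
  swap : ∀ n f → 2 * (n + 1) * f + 1 ≡ 2 * f * (n + 1) + 1
  swap = solve-∀

  cube≤ : ∀ n → threshold ≤ n → n ^ 3 ≤ 2 * size n
  cube≤ n N≤n = ℕ.*-cancelˡ-≤ 3 (begin
    3 * n ^ 3               ≤⟨ ℕ.*-monoʳ-≤ 3 (ℕ.m≤m+n (n ^ 3) (n ^ 2)) ⟩
    3 * (n ^ 3 + n ^ 2)     ≤⟨ ℕ.<⇒≤ (size-> n N≤n) ⟩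
    5 * size n              ≤⟨ ℕ.*-monoˡ-≤ (size n) (ℕ.n≤1+n 5) ⟩
    6 * size n              ≡⟨ ℕ.*-assoc 3 2 (size n) ⟩
    3 * (2 * size n)        ∎)
    where open ℕ.≤-Reasoning

  lower : ∀ n → threshold ≤ n → (+ 3 ℚ./ 5) ℚ.* (ℕ⇒ℚ (n ^ 3) ℚ.+ ℕ⇒ℚ (n ^ 2)) ℚ.< ℕ⇒ℚ (size n)
  -- Scaling by 5 reduces the claim to `size->`, with 5 · (3/5) = 3 holding by computation.
  lower n N≤n = ℚ.*-cancelˡ-<-nonNeg (ℕ⇒ℚ 5) (begin-strict
    ℕ⇒ℚ 5 ℚ.* ((+ 3 ℚ./ 5) ℚ.* s)        ≡⟨ ℚ.*-assoc (ℕ⇒ℚ 5) (+ 3 ℚ./ 5) s ⟨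
    ℕ⇒ℚ 3 ℚ.* s                          ≡⟨ cong (ℕ⇒ℚ 3 ℚ.*_) (ℕ⇒ℚ-+ (n ^ 3) (n ^ 2)) ⟨
    ℕ⇒ℚ 3 ℚ.* ℕ⇒ℚ (n ^ 3 + n ^ 2)        ≡⟨ ℕ⇒ℚ-* 3 (n ^ 3 + n ^ 2) ⟨
    ℕ⇒ℚ (3 * (n ^ 3 + n ^ 2))            <⟨ ℕ⇒ℚ-mono-< (size-> n N≤n) ⟩
    ℕ⇒ℚ (5 * size n)                     ≡⟨ ℕ⇒ℚ-* 5 (size n) ⟩
    ℕ⇒ℚ 5 ℚ.* ℕ⇒ℚ (size n)               ∎)
    where
    open ℚ.≤-Reasoning
    s = ℕ⇒ℚ (n ^ 3) ℚ.+ ℕ⇒ℚ (n ^ 2)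

  upper : ∀ n → 6 ≤ n → ℕ⇒ℚ (size n) ℚ.< ℕ⇒ℚ (n ^ 3) ℚ.- ℕ⇒ℚ n
  upper n 6≤n = begin-strict
    ℕ⇒ℚ (size n)                         ≡⟨ //-rightDividesʳ (ℕ⇒ℚ n) (ℕ⇒ℚ (size n)) ⟨
    ℕ⇒ℚ (size n) ℚ.+ ℕ⇒ℚ n ℚ.- ℕ⇒ℚ n     ≡⟨ cong (ℚ._- ℕ⇒ℚ n) (ℕ⇒ℚ-+ (size n) n) ⟨
    ℕ⇒ℚ (size n + n) ℚ.- ℕ⇒ℚ n           <⟨ ℚ.+-monoˡ-< (ℚ.- ℕ⇒ℚ n) (ℕ⇒ℚ-mono-< (size-< n 6≤n)) ⟩
    ℕ⇒ℚ (n ^ 3) ℚ.- ℕ⇒ℚ n                ∎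
    where open ℚ.≤-Reasoning
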